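{- Let $\mathcal{S} = (X, \xrightarrow{\Sigma}, \leq)$ be a very-WSTS and let $I_0$ be an ideal of $X$. Then the Ideal Karp-Miller algorithm, run on $\mathcal{S}$ from $I_0$, terminates.
   Context: A labeled transition system $\mathcal{S} = (X, \xrightarrow{\Sigma}, \leq)$ consists of a set $X$ of states, a finite alphabet $\Sigma$, a relation $\xrightarrow{a} \subseteq X \times X$ for each $a \in \Sigma$, and a quasi-ordering $\leq$ on $X$. It is a WSTS if $\leq$ is a well-quasi-ordering and it is monotone (if $x \xrightarrow{a} y$ and $x' \geq x$ then $x' \xrightarrow{*} y'$ for some $y' \geq y$). It has strong monotonicity if $x \xrightarrow{a} y$ and $x' \geq x$ imply $x' \xrightarrow{a} y'$ for some $y' \geq y$; it has strong-strict monotonicity if moreover $x \xrightarrow{a} y$ and $x' > x$ imply $x' \xrightarrow{a} y'$ for some $y' > y$. It is deterministic if each state has at most one $a$-successor for each $a \in \Sigma$. An ideal of $X$ is a nonempty downwards-closed directed subset of $X$; $\mathrm{Idl}(X)$ denotes the set of ideals. For a downwards-closed $D \subseteq X$, its ideal decomposition is the (finite) set of maximal ideals contained in $D$. The completion of $\mathcal{S}$ is the transition system $(\mathrm{Idl}(X), \xrightarrow{\Sigma}_{c}, \subseteq)$ where $I \xrightarrow{a}_{c} J$ iff $J$ belongs to the ideal decomposition of the downward closure of the set of $a$-successors of elements of $I$; it is finitely branching. When the completion is deterministic, $w(I)$ denotes the unique $w$-successor of $I$ in the completion, if defined. An acceleration candidate is a sequence $I_0 \subset I_1 \subset \cdots$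 of ideals. Levels: level $0$ of $\mathrm{Idl}(X)$ is $\mathrm{Idl}(X)$, and level $n>0$ is the set of unions $\bigcup_i I_i$ of acceleration candidates $I_0 \subset I_1 \subset \cdots$ of elements of level $n-1$. $\mathrm{Idl}(X)$ has finitely many levels if some level is empty. A very-WSTS is a WSTS $\mathcal{S}$ with strong monotonicity whose completion is a deterministic WSTS (in particular $\mathrm{Idl}(X)$ is well-quasi-ordered by $\subseteq$) with strong-strict monotonicity, and such that $\mathrm{Idl}(X)$ has finitely many levels. For $w \in \Sigma^+$ and an ideal $I$, the acceleration $w^\infty(I)$ is $\bigcup_{k \in \mathbb{N}} w^k(I)$ if $I \subset w(I)$, and $I$ otherwise. The Ideal Karp-Miller algorithm builds a tree whose nodes are labeled by pairs $\langle I, n\rangle$ (an ideal and a number of accelerations): it starts with a root labeled $\langle I_0, 0\rangle$; while there is an unmarked node $c : \langle I, n\rangle$, if $c$ has an ancestor labeled $\langle I', n'\rangle$ with $I' = I$ it marks $c$; otherwise, if $c$ has an ancestor $c' : \langle I', n'\rangle$ with $I' \subset I$ and $n' = n$, it replaces the label of $c$ by $\langle w^\infty(I), n+1\rangle$ where $w$ is the sequence of labels on the path from $c'$ to $c$; then, for every $a \in \Sigma$ such that $a(I)$ is defined (with $I$ the current ideal of $c$), it adds an $a$-labeled child of $c$ labeled $\langle a(I), n\rangle$ (with $n$ the current counter of $c$), and marks $c$. It returns the tree. -}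

module Defs where

open import Level using (Level; Lift; _⊔_) renaming (suc to lsuc)
open import Data.Bool.Base using (Bool; true; false)
open import Data.Fin.Base using (Fin)
open import Data.List.Base using (List; []; _∷_; [_]; _∷ʳ_; concat; replicate)
open import Data.Maybe.Base using (Maybe; just; nothing)
import Data.Maybe.Relation.Unary.All as Maybe
open import Data.Nat.Base using (ℕ; zero; suc; _<_)
open import Data.Product.Base using (Σ-syntax; ∃; ∃₂; _×_; _,_)
open import Data.Unit.Polymorphic.Base using (⊤)
open import Data.Vec.Base as Vec using (Vec; lookup; _[_]≔_)
import Data.Vec.Relation.Unary.All as Vec
open import Function.Base using (flip; _on_)
open import Function.Bundles using (_⇔_)
open import Induction.WellFounded using (Acc)
open import Relation.Binary.Bundles using (Preorder)
open import Relation.Binary.Core using (Rel)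
open import Relation.Binary.Definitions using (_Respects_; _Respects₂_)
open import Relation.Binary.Construct.Closure.ReflexiveTransitive using (Star)
open import Relation.Binary.PropositionalEquality.Core using (_≡_)
open import Relation.Nullary.Negation.Core using (¬_)
open import Relation.Unary using (Pred; _∈_; _⊆_; _⊂_; _≐_; Satisfiable; ⋃)

private
  variable
    a r p c ℓ₁ ℓ₂ t : Level

WellQuasiOrder : {A : Set a} → Rel A r → Set (a ⊔ r)
WellQuasiOrder {A = A} _≤_ =
  (f : ℕ → A) → ∃₂ λ i j → i < j × f i ≤ f j

-- Every run from x is finite, and a run can only stop in a final state
-- (so that getting stuck does not count as terminating).
Terminates : {A : Set a} → Rel A r → Pred A p → A → Set (a ⊔ r ⊔ p)
Terminates _⟶_ Final x =
  Acc (flip _⟶_) x ×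
  (∀ y → Star _⟶_ x y → (∀ z → ¬ (y ⟶ z)) → Final y)

------------------------------------------------------------------------
-- Labeled transition systems

-- The set of states is a setoid: states of the completion are ideals,
-- which are identified when they have the same elements.
record LTS (c ℓ₁ ℓ₂ t : Level) : Set (lsuc (c ⊔ ℓ₁ ⊔ ℓ₂ ⊔ t)) where
  field
    preorder     : Preorder c ℓ₁ ℓ₂
    alphabetSize : ℕ

  open Preorder preorder public
    using (_≈_) renaming (Carrier to State; _≲_ to _≤_)

  Letter : Set
  Letter = Fin alphabetSize

  field
    step        : Letter → Rel State t
    step-resp-≈ : ∀ α → step α Respects₂ _≈_

  _≺_ : Rel State ℓ₂
  x ≺ y = x ≤ y × ¬ (y ≤ x)

  anyStep : Rel State t
  anyStep x y = ∃ λ α → step α x y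

  steps : List Letter → Rel State (c ⊔ ℓ₁ ⊔ t)
  steps []      x y = Lift (c ⊔ t) (x ≈ y)
  steps (α ∷ w) x y = ∃ λ z → step α x z × steps w z y

  Monotone : Set (c ⊔ ℓ₂ ⊔ t)
  Monotone = ∀ {α x y x′} → step α x y → x ≤ x′ →
             ∃ λ y′ → Star anyStep x′ y′ × y ≤ y′

  StronglyMonotone : Set (c ⊔ ℓ₂ ⊔ t)
  StronglyMonotone = ∀ {α x y x′} → step α x y → x ≤ x′ →
                     ∃ λ y′ → step α x′ y′ × y ≤ y′

  StrongStrictlyMonotone : Set (c ⊔ ℓ₂ ⊔ t)
  StrongStrictlyMonotone =
    StronglyMonotone ×
    (∀ {α x y x′} → step α x y → x ≺ x′ →
     ∃ λ y′ → step α x′ y′ × y ≺ y′)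

  Deterministic : Set (c ⊔ ℓ₁ ⊔ t)
  Deterministic = ∀ {α x y z} → step α x y → step α x z → y ≈ z

  record IsWSTS : Set (c ⊔ ℓ₂ ⊔ t) where
    field
      wqo      : WellQuasiOrder _≤_
      monotone : Monotone

------------------------------------------------------------------------
-- Ideals and the completion

module _ (S : LTS c ℓ₁ ℓ₂ t) where
  open LTS S

  private
    ℓ : Level
    ℓ = c ⊔ ℓ₂ ⊔ t

  -- Subsets live at a level closed under taking the downward closure of
  -- a set of successors.
  record Ideal : Set (lsuc ℓ) where
    field
      pred     : Pred State ℓ
      nonempty : Satisfiable pred
      down     : pred Respects (flip _≤_)
      directed : ∀ {x y} → x ∈ pred → y ∈ pred →
                 ∃ λ z → z ∈ pred × x ≤ z × y ≤ z

  open Ideal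

  ↓Post : Letter → Pred State ℓ → Pred State ℓ
  ↓Post α D z = ∃₂ λ x y → x ∈ D × step α x y × z ≤ y

  InDecomposition : Pred State ℓ → Pred Ideal (lsuc ℓ)
  InDecomposition D J =
    pred J ⊆ D × (∀ K → pred K ⊆ D → pred J ⊆ pred K → pred K ⊆ pred J)

  idealPreorder : Preorder (lsuc ℓ) ℓ ℓ
  idealPreorder = record
    { Carrier    = Ideal
    ; _≈_        = _≐_ on pred
    ; _≲_        = λ I J → pred I ⊆ pred J
    ; isPreorder = record
      { isEquivalence = record
        { refl  = (λ x∈ → x∈) , (λ x∈ → x∈)
        ; sym   = λ (f , g) → g , f
        ; trans = λ (f , g) (h , k) → (λ x∈ → h (f x∈)) , (λ x∈ → g (k x∈))
        }
      ; reflexive = λ (f , _) → f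
      ; trans     = λ f g x∈ → g (f x∈)
      }
    }

  completion : LTS (lsuc ℓ) ℓ ℓ (lsuc ℓ)
  completion = record
    { preorder     = idealPreorder
    ; alphabetSize = alphabetSize
    ; step         = λ α I → InDecomposition (↓Post α (pred I))
    ; step-resp-≈  = λ α →
        (λ (f , g) (J⊆ , max) →
          (λ x∈ → J⊆ (g x∈)) ,
          (λ K K⊆ J′⊆K x∈ → f (max K K⊆ (λ y∈ → J′⊆K (f y∈)) x∈))) ,
        (λ (f , g) (J⊆ , max) →
          (λ z∈ → post f (J⊆ z∈)) ,
          (λ K K⊆ → max K (λ z∈ → post g (K⊆ z∈))))
    }
    where
    post : ∀ {α D E} → D ⊆ E → ↓Post α D ⊆ ↓Post α E
    post D⊆E (x , y , x∈ , x→y , z≤y) = x , y , D⊆E x∈ , x→y , z≤y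

  InLevel : ℕ → Pred Ideal (lsuc ℓ)
  InLevel zero    I = ⊤
  InLevel (suc n) I =
    Σ[ f ∈ (ℕ → Ideal) ]
      (∀ i → InLevel n (f i)) ×
      (∀ i → pred (f i) ⊂ pred (f (suc i))) ×
      pred I ≐ ⋃ ℕ (λ i → pred (f i))

  FinitelyManyLevels : Set (lsuc ℓ)
  FinitelyManyLevels = ∃ λ n → ∀ I → ¬ InLevel n I

  record IsVeryWSTS : Set (lsuc (c ⊔ ℓ₁ ⊔ ℓ₂ ⊔ t)) where
    field
      isWSTS                   : IsWSTS
      stronglyMonotone         : StronglyMonotone
      completion-isWSTS        : LTS.IsWSTS completion
      completion-deterministic : LTS.Deterministic completion
      completion-strongStrict  : LTS.StrongStrictlyMonotone completion
      finitelyManyLevels       : FinitelyManyLevels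

------------------------------------------------------------------------
-- The Ideal Karp-Miller algorithm

  module C = LTS completion

  _⊂[_]_ : Ideal → List Letter → Ideal → Set (lsuc ℓ)
  I ⊂[ w ] K = C.steps w I K × pred I ⊂ pred K

  -- Acceleration w I J  means  J = w^∞(I).
  data Acceleration (w : List Letter) (I J : Ideal) : Set (lsuc ℓ) where
    increasing :
      (∃ λ K → I ⊂[ w ] K) →
      (∀ x → x ∈ pred J ⇔
             (∃₂ λ k K → C.steps (concat (replicate k w)) I K × x ∈ pred K)) →
      Acceleration w I J
    stationary :
      ¬ (∃ λ K → I ⊂[ w ] K) → pred J ≐ pred I → Acceleration w I J

  -- A node carries its ideal, its number of accelerations, whether it is
  -- marked, and for each letter α an optional α-labeled child.
  data Tree : Set (lsuc ℓ) where
    node : Ideal → ℕ → Bool → Vec (Maybe Tree) alphabetSize → Tree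

  leaf : Ideal → ℕ → Tree
  leaf I n = node I n false (Vec.replicate _ nothing)

  -- The branch above a node, nearest ancestor first: the labels of each
  -- ancestor, and the letter of the edge along which the branch leaves it.
  Branch : Set (lsuc ℓ)
  Branch = List (Ideal × ℕ × Letter)

  -- Ancestor π I n w : some proper ancestor is labeled ⟨ I , n ⟩, and w is
  -- the word read from it down to the current node.
  data Ancestor : Branch → Ideal → ℕ → List Letter → Set (lsuc ℓ) where
    here  : ∀ {π I n α} → Ancestor ((I , n , α) ∷ π) I n [ α ]
    there : ∀ {π I n w J m α} → Ancestor π I n w →
            Ancestor ((J , m , α) ∷ π) I n (w ∷ʳ α)

  Repeated : Branch → Ideal → Set (lsuc ℓ)
  Repeated π I = ∃₂ λ I′ n′ → ∃ λ w → Ancestor π I′ n′ w × pred I′ ≐ pred I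

  Accelerable : Branch → Ideal → ℕ → List Letter → Set (lsuc ℓ)
  Accelerable π I n w = ∃ λ I′ → Ancestor π I′ n w × pred I′ ⊂ pred I

  data Child (I : Ideal) (n : ℕ) (α : Letter) : Pred (Maybe Tree) (lsuc ℓ) where
    defined   : ∀ {J} → C.step α I J → Child I n α (just (leaf J n))
    undefined : ¬ (∃ λ J → C.step α I J) → Child I n α nothing

  Children : Ideal → ℕ → Pred (Vec (Maybe Tree) alphabetSize) (lsuc ℓ)
  Children I n ts = ∀ α → Child I n α (lookup ts α)

  -- One iteration of the main loop, in the subtree below the branch π.
  -- Which unmarked node is treated, and which ancestor is used for the
  -- acceleration, are left open.
  data Step (π : Branch) : Rel Tree (lsuc ℓ) where
    repeat : ∀ {I n ts} →
      Repeated π I →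
      Step π (node I n false ts) (node I n true ts)
    accelerate : ∀ {I n ts w J us} →
      ¬ Repeated π I →
      Accelerable π I n w →
      Acceleration w I J →
      Children J (suc n) us →
      Step π (node I n false ts) (node J (suc n) true us)
    expand : ∀ {I n ts us} →
      ¬ Repeated π I →
      ¬ (∃ λ w → Accelerable π I n w) →
      Children I n us →
      Step π (node I n false ts) (node I n true us)
    below : ∀ {I n b ts α T T′} →
      lookup ts α ≡ just T →
      Step ((I , n , α) ∷ π) T T′ →
      Step π (node I n b ts) (node I n b (ts [ α ]≔ just T′))

  data FullyMarked : Pred Tree (lsuc ℓ) where
    node : ∀ {I n ts} → Vec.All (Maybe.All FullyMarked) ts →
           FullyMarked (node I n true ts)

{-# OPTIONS --safe #-}
module Submission where

-- Let a node of the tree be labeled ⟨I, n⟩.  Then I lies in level n of Idl(X):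
-- successors preserve levels because a(⋃ᵢ Iᵢ) = ⋃ᵢ a(Iᵢ), and an acceleration
-- enters the next level because, counters being monotone along branches, it
-- is applied to an I with I = w(I′) ⊃ I′.  As some level is empty, counters
-- are bounded.  Between two accelerations on a branch no ideal contains an
-- earlier one, so each such stretch is finite since Idl(X) is
-- well-quasi-ordered.  Finiteness of all branches gives finiteness of the run
-- by induction on branches, since each node has finitely many children.

open import Defs
open import Level using (Level; _⊔_; suc)
open import Data.List.Base using ([])
open import Axiom.ExcludedMiddle using (ExcludedMiddle)

open import Axiom.DoubleNegationElimination using (em⇒dne)
open import Data.Bool.Base using (true; false)
open import Data.Empty using (⊥-elim)
open import Data.Fin.Base as Fin using (Fin)
open import Data.List.Base using (List; _∷_; _++_; concat; replicate)
open import Data.Maybe.Base using (Maybe; just; nothing)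
import Data.Maybe.Relation.Unary.All as Maybe
open import Data.Nat.Base as ℕ using (ℕ; _+_; _<′_; ≤′-refl; ≤′-step)
open import Data.Nat.Properties using (<⇒<′; <-irrefl; m≤n⇒m≤1+n; m≤m+n;
  ≤-refl; ≤-total; ≤⇒≤′; +-suc; +-identityʳ)
open import Data.Product.Base using (Σ; ∃; ∃₂; _×_; _,_; proj₁; proj₂)
open import Data.Sum.Base using (_⊎_; inj₁; inj₂; swap)
open import Data.Vec.Base as Vec using (Vec; _∷_; []; lookup; _[_]≔_)
open import Data.Vec.Properties using (lookup-replicate; lookup∘tabulate)
import Data.Vec.Relation.Unary.All as Vec
open import Function.Base using (flip; _∘_)
open import Function.Bundles using (mk⇔; module Equivalence)
open import Induction.WellFounded using (WellFounded; Acc; acc)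
open import Level using (lift; lower)
open import Relation.Binary.Bundles using (Preorder)
open import Relation.Binary.Core using (Rel)
open import Relation.Binary.Definitions using (_Respects_)
open import Relation.Binary.PropositionalEquality.Core using (_≡_; refl; sym; trans; subst)
open import Relation.Nullary using (¬_; yes; no)
open import Relation.Nullary.Decidable using (map′)
open import Relation.Unary using (Pred; _∈_; _∉_; _⊆_; _⊈_; _⊂_; _≐_; ⋃)

-- Classical logic and well-founded descent of downward-closed sets.

em-lower : ∀ a {b} → ExcludedMiddle (a ⊔ b) → ExcludedMiddle a
em-lower a {b} em = map′ lower lift (em {P = Level.Lift b _})

⊈⇒∃∉ : ∀ {a p} {A : Set a} → ExcludedMiddle (a ⊔ p) →
       {P Q : Pred A p} → P ⊈ Q → ∃ λ x → x ∈ P × x ∉ Q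
⊈⇒∃∉ {a} {p} em P⊈Q = em⇒dne em λ none →
  P⊈Q λ {x} x∈P → em⇒dne (em-lower p {a} em) λ x∉Q → none (x , x∈P , x∉Q)

-- An infinite descent D₀ ⊃ D₁ ⊃ ⋯ yields the bad sequence xᵢ ∈ Dᵢ ∖ Dᵢ₊₁.
⊂-wellFounded :
  ∀ {a b p r} {A : Set a} {B : Set b} {_≤_ : Rel A r} →
  ExcludedMiddle (a ⊔ b ⊔ p) → WellQuasiOrder _≤_ →
  (D : B → Pred A p) → (∀ β → D β Respects flip _≤_) →
  WellFounded λ β γ → D β ⊂ D γ
⊂-wellFounded {a} {b} {p} {B = B} em wqo D down β₀ = em⇒dne em descent
  where
  Inaccessible : Set (a ⊔ b ⊔ p)
  Inaccessible = ∃ λ β → ¬ Acc (λ β γ → D β ⊂ D γ) β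

  next : (s : Inaccessible) → ∃ λ (s′ : Inaccessible) → D (proj₁ s′) ⊂ D (proj₁ s)
  next (β , ¬acc) = em⇒dne em λ none →
    ¬acc (acc λ {γ} γ⊂β → em⇒dne em λ ¬accγ → none ((γ , ¬accγ) , γ⊂β))

  descent : ¬ ¬ Acc (λ β γ → D β ⊂ D γ) β₀
  descent ¬acc = contradict (wqo (proj₁ ∘ pick))
    where
    seq : ℕ → Inaccessible
    seq ℕ.zero    = β₀ , ¬acc
    seq (ℕ.suc i) = proj₁ (next (seq i))

    E : ℕ → Pred _ p
    E i = D (proj₁ (seq i))

    pick : ∀ i → ∃ λ x → x ∈ E i × x ∉ E (ℕ.suc i)
    pick i = ⊈⇒∃∉ (em-lower (a ⊔ p) {b} em) (proj₂ (proj₂ (next (seq i))))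

    antitone : ∀ {i j} → i <′ j → E j ⊆ E (ℕ.suc i)
    antitone ≤′-refl           x∈ = x∈
    antitone (≤′-step {j} i<j) x∈ = antitone i<j (proj₁ (proj₂ (next (seq j))) x∈)

    contradict : ¬ _
    contradict (i , j , i<j , xᵢ≤xⱼ) =
      -- Since `i < j`, `xⱼ` lies in `E (suc i)`; downward closure then puts `xᵢ` there as well,
      -- which `pick i` excludes.
      proj₂ (proj₂ (pick i))
        (down _ xᵢ≤xⱼ (antitone (<⇒<′ i<j) (proj₁ (proj₂ (pick j)))))

-- Words and their iteration in a transition system.

module Words {c ℓ₁ ℓ₂ t} (S : LTS c ℓ₁ ℓ₂ t) where
  open LTS S
  private
    module P = Preorder preorder

  steps-++ : ∀ v {w x y z} → steps v x y → steps w y z → steps (v ++ w) x z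
  steps-++ []      {[]}    (lift x≈y)    (lift y≈z)    = lift (P.Eq.trans x≈y y≈z)
  steps-++ []      {α ∷ _} (lift x≈y)    (u , s , ss)  =
    u , proj₂ (step-resp-≈ α) (P.Eq.sym x≈y) s , ss
  steps-++ (_ ∷ v)         (u , s , ss)  ss′           = u , s , steps-++ v ss ss′

  steps-deterministic : Deterministic → ∀ w {x x′ y y′} → x ≈ x′ →
                        steps w x y → steps w x′ y′ → y ≈ y′
  steps-deterministic det []      x≈x′ (lift x≈y) (lift x′≈y′) =
    P.Eq.trans (P.Eq.sym x≈y) (P.Eq.trans x≈x′ x′≈y′)
  steps-deterministic det (α ∷ w) x≈x′ (_ , s , ss) (_ , s′ , ss′) =
    steps-deterministic det w
      (det s (proj₂ (step-resp-≈ α) (P.Eq.sym x≈x′) s′)) ss ss′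

  module Iteration (mono : StrongStrictlyMonotone) where

    steps-strictlyMonotone : ∀ w {x y x′} → steps w x y → x ≺ x′ →
                             ∃ λ y′ → steps w x′ y′ × y ≺ y′
    steps-strictlyMonotone [] {x′ = x′} (lift x≈y) (x≤x′ , x′≰x) =
      x′ , lift P.Eq.refl ,
      P.trans (P.reflexive (P.Eq.sym x≈y)) x≤x′ ,
      λ x′≤y → x′≰x (P.trans x′≤y (P.reflexive (P.Eq.sym x≈y)))
    steps-strictlyMonotone (α ∷ w) (_ , s , ss) x≺x′ =
      let u , s′ , lt   = proj₂ mono s x≺x′
          y , ss′ , lt′ = steps-strictlyMonotone w ss lt
      in  y , (u , s′ , ss′) , lt′

    Increasing : List Letter → Set _
    Increasing w = ∃₂ λ x y → steps w x y × x ≺ y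

    module _ {w : List Letter} where

      next : Increasing w → Increasing w
      next (_ , y , ss , lt) = y , steps-strictlyMonotone w ss lt

      -- The state `w^k(x)`. The recursion moves the starting point from `x` to `w(x)`, matching the
      -- unfolding of `concat (replicate (suc k) w)`, in which one copy of `w` is read first.
      iterate : Increasing w → ℕ → State
      iterate p ℕ.zero    = proj₁ p
      iterate p (ℕ.suc k) = iterate (next p) k

      iterate-steps : ∀ p k → steps (concat (replicate k w)) (proj₁ p) (iterate p k)
      iterate-steps p ℕ.zero    = lift P.Eq.refl
      iterate-steps p@(_ , _ , ss , _) (ℕ.suc k) =
        steps-++ w ss (iterate-steps (next p) k)

      iterate-≺ : ∀ p k → iterate p k ≺ iterate p (ℕ.suc k)
      iterate-≺ (_ , _ , _ , lt) ℕ.zero    = lt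
      iterate-≺ p                (ℕ.suc k) = iterate-≺ (next p) k

-- Ideals and the existence of maximal ideals in downward-closed sets.

module Ideals {c ℓ₁ ℓ₂ t} (em : ExcludedMiddle (suc (c ⊔ ℓ₂ ⊔ t))) (S : LTS c ℓ₁ ℓ₂ t) where
  open LTS S
  open Ideal
  private
    ℓ : Level
    ℓ = c ⊔ ℓ₂ ⊔ t

    module P = Preorder preorder

    emℓ : ExcludedMiddle ℓ
    emℓ = em-lower ℓ {suc ℓ} em

  principal : State → Ideal S
  principal x = record
    { pred     = λ y → Level.Lift ℓ (y ≤ x)
    ; nonempty = x , lift P.refl
    ; down     = λ z≤y (lift y≤x) → lift (P.trans z≤y y≤x)
    ; directed = λ (lift y≤x) (lift z≤x) → x , lift P.refl , y≤x , z≤x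
    }

  chain-mono : (f : ℕ → Ideal S) → (∀ i → pred (f i) ⊆ pred (f (ℕ.suc i))) →
               ∀ {i j} → i ℕ.≤′ j → pred (f i) ⊆ pred (f j)
  chain-mono f f⊆ ≤′-refl           x∈ = x∈
  chain-mono f f⊆ (≤′-step {j} i≤j) x∈ = f⊆ j (chain-mono f f⊆ i≤j x∈)

  union : (f : ℕ → Ideal S) → (∀ i → pred (f i) ⊆ pred (f (ℕ.suc i))) → Ideal S
  union f f⊆ = record
    { pred     = ⋃ ℕ (pred ∘ f)
    ; nonempty = let x , x∈ = nonempty (f 0) in x , 0 , x∈
    ; down     = λ y≤x (i , x∈) → i , down (f i) y≤x x∈
    ; directed = λ (i , x∈) (j , y∈) → directed-⋃ i j x∈ y∈
    }
    where
    bound : ∀ {x y} i → x ∈ pred (f i) → y ∈ pred (f i) →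
            ∃ λ z → z ∈ ⋃ ℕ (pred ∘ f) × x ≤ z × y ≤ z
    bound i x∈ y∈ = let z , z∈ , x≤z , y≤z = directed (f i) x∈ y∈
                    in  z , (i , z∈) , x≤z , y≤z

    directed-⋃ : ∀ {x y} i j → x ∈ pred (f i) → y ∈ pred (f j) →
                 ∃ λ z → z ∈ ⋃ ℕ (pred ∘ f) × x ≤ z × y ≤ z
    directed-⋃ i j x∈ y∈ with ≤-total i j
    ... | inj₁ i≤j = bound j (chain-mono f f⊆ (≤⇒≤′ i≤j) x∈) y∈
    ... | inj₂ j≤i = bound i x∈ (chain-mono f f⊆ (≤⇒≤′ j≤i) y∈)

  ExtendsToMaximal : Pred State ℓ → Set (suc ℓ)
  ExtendsToMaximal D = (K : Ideal S) → pred K ⊆ D →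
                       ∃ λ J → InDecomposition S D J × pred K ⊆ pred J

  -- An ideal maximal in D₁ can fail to be maximal in D only when it
  -- also lies in D₂, where it can be extended once more.
  extendsToMaximal-∪ˡ : {D D₁ D₂ : Pred State ℓ} → D₁ ⊆ D → D₂ ⊆ D →
    ((L : Ideal S) → pred L ⊆ D → pred L ⊆ D₁ ⊎ pred L ⊆ D₂) →
    ExtendsToMaximal D₁ → ExtendsToMaximal D₂ →
    (K : Ideal S) → pred K ⊆ D₁ → ∃ λ J → InDecomposition S D J × pred K ⊆ pred J
  extendsToMaximal-∪ˡ {D} {D₁} {D₂} D₁⊆D D₂⊆D cover ext₁ ext₂ K K⊆D₁
    with ext₁ K K⊆D₁
  ... | J₁ , (J₁⊆D₁ , max₁) , K⊆J₁ with emℓ {P = pred J₁ ⊆ D₂}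
  ...   | no J₁⊈D₂ = J₁ , ((λ x∈ → D₁⊆D (J₁⊆D₁ x∈)) , max) , K⊆J₁
    where
    max : (L : Ideal S) → pred L ⊆ D → pred J₁ ⊆ pred L → pred L ⊆ pred J₁
    max L L⊆D J₁⊆L with cover L L⊆D
    ... | inj₁ L⊆D₁ = max₁ L L⊆D₁ J₁⊆L
    ... | inj₂ L⊆D₂ = ⊥-elim (J₁⊈D₂ λ x∈ → L⊆D₂ (J₁⊆L x∈))
  ...   | yes J₁⊆D₂ with ext₂ J₁ J₁⊆D₂
  ...     | J₂ , (J₂⊆D₂ , max₂) , J₁⊆J₂ =
    J₂ , ((λ x∈ → D₂⊆D (J₂⊆D₂ x∈)) , max) , λ x∈ → J₁⊆J₂ (K⊆J₁ x∈)
    where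
    max : (L : Ideal S) → pred L ⊆ D → pred J₂ ⊆ pred L → pred L ⊆ pred J₂
    max L L⊆D J₂⊆L with cover L L⊆D
    ... | inj₁ L⊆D₁ = λ x∈ → J₁⊆J₂ (max₁ L L⊆D₁ (λ y∈ → J₂⊆L (J₁⊆J₂ y∈)) x∈)
    ... | inj₂ L⊆D₂ = max₂ L L⊆D₂ J₂⊆L

  private
    DownSet : Set (suc ℓ)
    DownSet = Σ (Pred State ℓ) (_Respects flip _≤_)

    -- If x and y have no common upper bound in D, then D is the union of
    -- its proper subsets D ∖ ↑x and D ∖ ↑y.
    _∖↑_ : DownSet → State → DownSet
    (D , dn) ∖↑ x = (λ z → z ∈ D × ¬ (x ≤ z)) ,
                    λ y≤z (z∈ , x≰z) → dn y≤z z∈ , λ x≤y → x≰z (P.trans x≤y y≤z)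

    ∖↑-⊂ : ∀ D {x} → x ∈ proj₁ D → proj₁ (D ∖↑ x) ⊂ proj₁ D
    ∖↑-⊂ D x∈ = proj₁ , λ D⊆ → proj₂ (D⊆ x∈) P.refl

    -- An ideal with one element above `x` and another above `y` would, by directedness, contain an
    -- element above both.
    ∖↑-cover : ∀ D {x y} → (∀ z → z ∈ proj₁ D → x ≤ z → ¬ (y ≤ z)) →
               (L : Ideal S) → pred L ⊆ proj₁ D →
               pred L ⊆ proj₁ (D ∖↑ x) ⊎ pred L ⊆ proj₁ (D ∖↑ y)
    ∖↑-cover D {x} unbounded L L⊆D with emℓ {P = pred L ⊆ proj₁ (D ∖↑ x)}
    ... | yes L⊆ = inj₁ L⊆
    ... | no  L⊈ = inj₂ λ {k} k∈ → L⊆D k∈ , λ y≤k → L⊈ λ {l} l∈ → L⊆D l∈ , λ x≤l →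
      let z , z∈ , l≤z , k≤z = directed L l∈ k∈
      in  unbounded z (L⊆D z∈) (P.trans x≤l l≤z) (P.trans y≤k k≤z)

  -- Well-founded induction on downward-closed sets under proper inclusion. If any two elements of
  -- `D` have an upper bound in `D`, then `D` is itself an ideal, nonempty because it contains `K`.
  -- Otherwise it splits into two smaller downward-closed sets, and every ideal inside `D` lies in
  -- one of them.
  extendsToMaximal : WellQuasiOrder _≤_ → (D : Pred State ℓ) → D Respects flip _≤_ →
                     ExtendsToMaximal D
  extendsToMaximal wqo D₀ dn₀ = go (D₀ , dn₀) (⊂-wellFounded em wqo proj₁ proj₂ _)
    where
    go : ∀ (D : DownSet) → Acc (λ D E → proj₁ D ⊂ proj₁ E) D → ExtendsToMaximal (proj₁ D)
    go DD@(D , dn) (acc rs) K K⊆D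
      with emℓ {P = ∃₂ λ x y → x ∈ D × y ∈ D × (∀ z → z ∈ D → x ≤ z → ¬ (y ≤ z))}
    ... | no allBounded = whole , ((λ x∈ → x∈) , λ L L⊆D _ → L⊆D) , K⊆D
      where
      whole : Ideal S
      whole = record
        { pred     = D
        ; nonempty = let x , x∈ = nonempty K in x , K⊆D x∈
        ; down     = dn
        ; directed = λ {x} {y} x∈ y∈ → em⇒dne emℓ λ unbounded →
            allBounded (x , y , x∈ , y∈ , λ z z∈ x≤z y≤z → unbounded (z , z∈ , x≤z , y≤z))
        }
    ... | yes (x , y , x∈ , y∈ , unbounded) with ∖↑-cover DD unbounded K K⊆D
    ...   | inj₁ K⊆ = extendsToMaximal-∪ˡ proj₁ proj₁ (∖↑-cover DD unbounded)
                        (go (DD ∖↑ x) (rs (∖↑-⊂ DD x∈))) (go (DD ∖↑ y) (rs (∖↑-⊂ DD y∈))) K K⊆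
    ...   | inj₂ K⊆ = extendsToMaximal-∪ˡ proj₁ proj₁
                        (λ L L⊆D → swap (∖↑-cover DD unbounded L L⊆D))
                        (go (DD ∖↑ y) (rs (∖↑-⊂ DD y∈))) (go (DD ∖↑ x) (rs (∖↑-⊂ DD x∈))) K K⊆

-- Levels of ideals under successors and accelerations.

module Levels {c ℓ₁ ℓ₂ t} (em : ExcludedMiddle (suc (c ⊔ ℓ₂ ⊔ t)))
              (S : LTS c ℓ₁ ℓ₂ t) (very : IsVeryWSTS S) where
  open LTS S
  open Ideal
  open IsVeryWSTS very
  open Ideals em S
  private
    ℓ : Level
    ℓ = c ⊔ ℓ₂ ⊔ t

    module P = Preorder preorder
    module Comp = LTS (completion S)

  open Words (completion S)
  open Iteration completion-strongStrict public

  -- The principal ideal of `z` lies in the downward closure, so some maximal ideal extends it.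
  ↓Post-⊆-maximal : ∀ α I {z} → z ∈ ↓Post S α (pred I) →
                    ∃ λ J → Comp.step α I J × z ∈ pred J
  ↓Post-⊆-maximal α I {z} z∈ =
    let J , J-max , ↓z⊆J = extendsToMaximal (IsWSTS.wqo isWSTS) (↓Post S α (pred I)) dn
                             (principal z) λ (lift y≤z) → dn y≤z z∈
    in  J , J-max , ↓z⊆J (lift P.refl)
    where
    dn : ↓Post S α (pred I) Respects flip _≤_
    dn y≤x (u , v , u∈ , u→v , x≤v) = u , v , u∈ , u→v , P.trans y≤x x≤v

  -- Every element of the downward closure lies in some successor of `I`, and determinism identifies
  -- that successor with `J`.
  step-≐-↓Post : ∀ {α} {I J : Ideal S} → Comp.step α I J → pred J ≐ ↓Post S α (pred I)
  step-≐-↓Post {α} {I} {J} I→J = proj₁ I→J , λ z∈ →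
    let K , I→K , z∈K = ↓Post-⊆-maximal α I z∈
    in  proj₁ (completion-deterministic {α} {I} {K} {J} I→K I→J) z∈K

  InLevel-resp-≐ : ∀ n {I J : Ideal S} → pred I ≐ pred J → InLevel S n I → InLevel S n J
  InLevel-resp-≐ ℕ.zero    _       _ = _
  InLevel-resp-≐ (ℕ.suc n) (f , g) (I , lev , I⊂ , h , k) =
    I , lev , I⊂ , (λ x∈ → h (g x∈)) , λ x∈ → f (k x∈)

  -- a(⋃ᵢ Iᵢ) = ⋃ᵢ a(Iᵢ), where the union may skip the Iᵢ on which a is undefined.
  step-InLevel : ∀ n {α} {I J : Ideal S} → Comp.step α I J → InLevel S n I → InLevel S n J
  step-InLevel ℕ.zero    _ _ = _
  step-InLevel (ℕ.suc n) {α} {I} {J} I→J (f , lev , f⊂ , I⊆⋃ , ⋃⊆I)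
    -- A transition `x₀ → y₀` witnessing that `J` is nonempty has its source in some `f m`. From
    -- index `m` on, every ideal of the chain contains `x₀` and so has an `α`-successor; the new
    -- chain starts there.
    with nonempty J
  ... | z₀ , z₀∈J with proj₁ I→J z₀∈J
  ... | x₀ , y₀ , x₀∈I , x₀→y₀ , _ with I⊆⋃ x₀∈I
  ... | m , x₀∈fm = g , (λ i → step-InLevel n {α} {f (i + m)} {g i} (f→g i) (lev (i + m))) , g⊂ , J⊆⋃ , ⋃⊆J
    where
    f⊆ : ∀ i → pred (f i) ⊆ pred (f (ℕ.suc i))
    f⊆ i = proj₁ (f⊂ i)

    from : ∀ i → pred (f m) ⊆ pred (f (i + m))
    from ℕ.zero    x∈ = x∈
    from (ℕ.suc i) x∈ = f⊆ (i + m) (from i x∈)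

    successor : ∀ i → ∃ λ K → Comp.step α (f (i + m)) K × y₀ ∈ pred K
    successor i = ↓Post-⊆-maximal α (f (i + m)) (x₀ , y₀ , from i x₀∈fm , x₀→y₀ , P.refl)

    g : ℕ → Ideal S
    g i = proj₁ (successor i)

    f→g : ∀ i → Comp.step α (f (i + m)) (g i)
    f→g i = proj₁ (proj₂ (successor i))

    g⊂ : ∀ i → pred (g i) ⊂ pred (g (ℕ.suc i))
    g⊂ i =
      -- Strict monotonicity yields some successor `K` strictly above `g i`; determinism identifies
      -- it with the chosen `g (suc i)`.
      let K , f→K , gi⊆K , K⊈gi = proj₂ completion-strongStrict {α} {f (i + m)} {g i} {f (ℕ.suc i + m)}
                                    (f→g i) (f⊂ (i + m))
          K⊆g , g⊆K = completion-deterministic {α} {f (ℕ.suc i + m)} {K} {g (ℕ.suc i)} f→K (f→g (ℕ.suc i))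
      in  (λ x∈ → K⊆g (gi⊆K x∈)) , λ g⊆gi → K⊈gi λ x∈ → g⊆gi (K⊆g x∈)

    shift : ∀ {x} i → x ∈ pred (f i) → x ∈ pred (f (i + m))
    shift i x∈ = chain-mono f f⊆ (≤⇒≤′ (m≤m+n i m)) x∈

    J⊆⋃ : pred J ⊆ ⋃ ℕ (pred ∘ g)
    J⊆⋃ z∈J =
      let x , y , x∈I , x→y , z≤y = proj₁ I→J z∈J
          i , x∈fi                = I⊆⋃ x∈I
      in  i , proj₂ (step-≐-↓Post {α} {f (i + m)} {g i} (f→g i)) (x , y , shift i x∈fi , x→y , z≤y)

    ⋃⊆J : ⋃ ℕ (pred ∘ g) ⊆ pred J
    ⋃⊆J (i , z∈g) =
      let x , y , x∈f , x→y , z≤y = proj₁ (f→g i) z∈g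
      in  proj₂ (step-≐-↓Post {α} {I} {J} I→J) (x , y , ⋃⊆I (i + m , x∈f) , x→y , z≤y)

  iterates : ∀ {w} (p : Increasing w) {x} →
             x ∈ ⋃ ℕ (pred ∘ iterate p) →
             ∃₂ λ k K → Comp.steps (concat (replicate k w)) (proj₁ p) K × x ∈ pred K
  iterates p (k , x∈) = k , iterate p k , iterate-steps p k , x∈

  -- By determinism, any `K` reached by `k` copies of `w` has the same elements as `iterate p k`.
  iterates⁻¹ : ∀ {w} (p : Increasing w) {x} →
               (∃₂ λ k K → Comp.steps (concat (replicate k w)) (proj₁ p) K × x ∈ pred K) →
               x ∈ ⋃ ℕ (pred ∘ iterate p)
  iterates⁻¹ {w} p (k , K , ss , x∈K) =
    k , proj₁ (steps-deterministic (λ {α} {I} {J} {L} → completion-deterministic {α} {I} {J} {L})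
                 (concat (replicate k w)) {proj₁ p} {proj₁ p} {K} {iterate p k}
                 ((λ x∈ → x∈) , λ x∈ → x∈) ss (iterate-steps p k)) x∈K

  steps-InLevel : ∀ n w {I J : Ideal S} → Comp.steps w I J → InLevel S n I → InLevel S n J
  steps-InLevel n []      {I} {J} (lift I≐J)    lev = InLevel-resp-≐ n {I} {J} I≐J lev
  steps-InLevel n (α ∷ w) {I} {J} (K , s , ss) lev =
    steps-InLevel n w {K} {J} ss (step-InLevel n {α} {I} {K} s lev)

  iterate-InLevel : ∀ n {w} (p : Increasing w) → InLevel S n (proj₁ p) →
                    ∀ k → InLevel S n (iterate p k)
  iterate-InLevel n     p                  lev ℕ.zero    = lev
  iterate-InLevel n {w} p@(I , K , ss , _) lev (ℕ.suc k) =
    iterate-InLevel n (next p) (steps-InLevel n w {I} {K} ss lev) k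

  -- The iterates of `w` form an acceleration candidate within level `n` whose union is `J`; the
  -- stationary case contradicts `p`.
  acceleration-InLevel : ∀ n {w} (p : Increasing w) {J : Ideal S} → InLevel S n (proj₁ p) →
                         Acceleration S w (proj₁ p) J → InLevel S (ℕ.suc n) J
  acceleration-InLevel n p lev (increasing _ char) =
    iterate p , iterate-InLevel n p lev , iterate-≺ p ,
    (λ {x} x∈ → iterates⁻¹ p (Equivalence.to (char x) x∈)) ,
    (λ {x} x∈ → Equivalence.from (char x) (iterates p x∈))
  acceleration-InLevel n (_ , K , ss , lt) lev (stationary ¬inc _) =
    ⊥-elim (¬inc (K , ss , lt))

  acceleration-exists : ∀ w I → ∃ (Acceleration S w I)
  acceleration-exists w I with em {P = ∃ λ K → _⊂[_]_ S I w K}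
  ... | no ¬inc = I , stationary ¬inc ((λ x∈ → x∈) , λ x∈ → x∈)
  ... | yes (K , ss , lt) =
    union (iterate p) (λ k → proj₁ (iterate-≺ p k)) ,
    increasing (K , ss , lt) λ x → mk⇔ (iterates p) (iterates⁻¹ p)
    where
    p : Increasing w
    p = I , K , ss , lt

-- Interleaved runs of finitely many components.

module _ {a r : Level} {A : Set a} where

  -- The relation varies with the position because the branch above a child records the letter of
  -- its edge.
  Update : ∀ {k} → (Fin k → Rel A r) → Rel (Vec (Maybe A) k) (a ⊔ r)
  Update R us vs = ∃ λ α → ∃₂ λ T T′ →
    lookup us α ≡ just T × R α T T′ × vs ≡ us [ α ]≔ just T′

  nothing-∷-acc : ∀ {k} {R : Fin (ℕ.suc k) → Rel A r} {us} →
                  Acc (flip (Update (R ∘ Fin.suc))) us →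
                  Acc (flip (Update R)) (nothing ∷ us)
  nothing-∷-acc {R = R} (acc rs) = acc step
    where
    step : ∀ {vs} → Update R (nothing ∷ _) vs → Acc (flip (Update R)) vs
    step (Fin.suc α , T , T′ , eq , s , refl) =
      nothing-∷-acc (rs (α , T , T′ , eq , s , refl))

  -- Induction on both accessibility proofs: each step descends in one and keeps the other.
  just-∷-acc : ∀ {k} {R : Fin (ℕ.suc k) → Rel A r} {T us} →
               Acc (flip (R Fin.zero)) T →
               Acc (flip (Update (R ∘ Fin.suc))) us →
               Acc (flip (Update R)) (just T ∷ us)
  just-∷-acc {R = R} accT@(acc rsT) accus@(acc rsus) = acc step
    where
    step : ∀ {vs} → Update R (just _ ∷ _) vs → Acc (flip (Update R)) vs
    step (Fin.zero , _ , _ , refl , s , refl) = just-∷-acc (rsT s) accus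
    step (Fin.suc α , T , T′ , eq , s , refl) =
      just-∷-acc accT (rsus (α , T , T′ , eq , s , refl))

  Update-acc : ∀ {k} {R : Fin k → Rel A r} us →
               (∀ α → Maybe.All (Acc (flip (R α))) (lookup us α)) →
               Acc (flip (Update R)) us
  Update-acc []             _    = acc λ { (() , _) }
  Update-acc (nothing ∷ us) accs = nothing-∷-acc (Update-acc us (accs ∘ Fin.suc))
  Update-acc (just _ ∷ us)  accs =
    just-∷-acc (Maybe.drop-just (accs Fin.zero)) (Update-acc us (accs ∘ Fin.suc))

-- Finiteness of the runs of the algorithm.

module KarpMiller {c ℓ₁ ℓ₂ t} (em : ExcludedMiddle (suc (c ⊔ ℓ₂ ⊔ t)))
                  (S : LTS c ℓ₁ ℓ₂ t) (very : IsVeryWSTS S) where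
  open Ideal
  open IsVeryWSTS very
  open Levels em S very
  private
    ℓ : Level
    ℓ = c ⊔ ℓ₂ ⊔ t

    module Comp = LTS (completion S)

  open Words (completion S) using (steps-++)

  -- The ideals that neither repeat nor may be accelerated from an
  -- ancestor with counter n.
  Fresh : ℕ → Branch S → Pred (Ideal S) (suc ℓ)
  Fresh n π K = ∀ {I w} → Ancestor S π I n w → pred I ⊈ pred K

  -- Each `Fresh n π` is downward closed in the ideals ordered by inclusion, which are
  -- well-quasi-ordered.
  Fresh-wellFounded : ∀ n → WellFounded λ π ρ → Fresh n π ⊂ Fresh n ρ
  Fresh-wellFounded n =
    ⊂-wellFounded {_≤_ = Comp._≤_} em (Comp.IsWSTS.wqo completion-isWSTS) (Fresh n)
      λ π K⊆L fresh anc I⊆K → fresh anc λ x∈ → K⊆L (I⊆K x∈)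

  -- The inclusion is proper because `I` is fresh for `π` but not once it is an ancestor itself.
  Fresh-∷-⊂ : ∀ {π I n α} → ¬ Repeated S π I → ¬ (∃ λ w → Accelerable S π I n w) →
              Fresh n ((I , n , α) ∷ π) ⊂ Fresh n π
  Fresh-∷-⊂ {π} {I} {n} ¬rep ¬accel =
    (λ fresh anc → fresh (there anc)) ,
    λ Fresh⊆ → Fresh⊆ {I} I-fresh here λ x∈ → x∈
    where
    I-fresh : I ∈ Fresh n π
    I-fresh {I′} anc I′⊆I = ¬accel (_ , I′ , anc , I′⊆I , λ I⊆I′ →
      ¬rep (I′ , n , _ , anc , I′⊆I , I⊆I′))

  -- `reached` is confined to ancestors with the current counter, since an acceleration breaks
  -- `w(I′) = I`. `bounded` makes it vacuous right after an acceleration: no ancestor has the new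
  -- counter yet.
  record Invariant (π : Branch S) (I : Ideal S) (n : ℕ) : Set (suc ℓ) where
    field
      inLevel : InLevel S n I
      reached : ∀ {I′ w} → Ancestor S π I′ n w → Comp.steps w I′ I
      bounded : ∀ {I′ n′ w} → Ancestor S π I′ n′ w → n′ ℕ.≤ n

  open Invariant

  invariant-step : ∀ {π I n α K} → Comp.step α I K → Invariant π I n →
                   Invariant ((I , n , α) ∷ π) K n
  invariant-step {π} {I} {n} {α} {K} I→K inv = record
    { inLevel = step-InLevel n {α} {I} {K} I→K (inLevel inv)
    ; reached = reached′
    ; bounded = λ { here → ≤-refl ; (there anc) → bounded inv anc }
    }
    where
    [α] : Comp.steps (α ∷ []) I K
    [α] = K , I→K , lift ((λ x∈ → x∈) , λ x∈ → x∈)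

    reached′ : ∀ {I′ w} → Ancestor S ((I , n , α) ∷ π) I′ n w → Comp.steps w I′ K
    reached′ here                    = [α]
    reached′ (there {w = w} anc) = steps-++ w (reached inv anc) [α]

  -- An ancestor I′ with the same counter satisfies w(I′) = I, so I′ ⊂ I
  -- gives I ⊂ w(I) by strict monotonicity and w^∞(I) is one level up.
  invariant-accelerate : ∀ {π I n w J} → Accelerable S π I n w → Acceleration S w I J →
                         Invariant π I n → Invariant π J (ℕ.suc n)
  invariant-accelerate {I = I} {n} {w} (I′ , anc , I′⊂I) accel inv = record
    { inLevel = acceleration-InLevel n (next (I′ , I , reached inv anc , I′⊂I))
                  (inLevel inv) accel
    ; reached = λ anc′ → ⊥-elim (<-irrefl refl (bounded inv anc′))
    ; bounded = λ anc′ → m≤n⇒m≤1+n (bounded inv anc′)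
    }

  -- A marked node changes only through its children.
  node-acc : ∀ {π I n us} →
             Acc (flip (Update λ α → Step S ((I , n , α) ∷ π))) us →
             Acc (flip (Step S π)) (node I n true us)
  node-acc (acc rs) = acc λ { (below eq s) → node-acc (rs (_ , _ , _ , eq , s , refl)) }

  children-acc : ∀ {π I n us} → Children S I n us →
    (∀ {α K} → Comp.step α I K → Acc (flip (Step S ((I , n , α) ∷ π))) (leaf S K n)) →
    Acc (flip (Step S π)) (node I n true us)
  children-acc {π} {I} {n} {us} children leaf-acc =
    node-acc (Update-acc us λ α → child-acc (children α))
    where
    child-acc : ∀ {α m} → Child S I n α m →
                Maybe.All (Acc (flip (Step S ((I , n , α) ∷ π)))) m
    child-acc (defined I→K) = Maybe.just (leaf-acc I→K)
    child-acc (undefined _) = Maybe.nothing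

  childless : ∀ {k} (α : Fin k) {T : Tree S} → ¬ lookup (Vec.replicate k nothing) α ≡ just T
  childless α eq with trans (sym (lookup-replicate α nothing)) eq
  ... | ()

  -- Lexicographic induction: `k` counts the levels left below the empty one and drops with each
  -- acceleration; an expansion keeps `k` and shrinks the set of fresh ideals. At `k = 0` the ideal
  -- `I` would lie in the empty level.
  leaf-acc : ∀ k {n} → (∀ K → ¬ InLevel S (k + n) K) →
             ∀ {π I} → Acc (λ π ρ → Fresh n π ⊂ Fresh n ρ) π →
             Invariant π I n → Acc (flip (Step S π)) (leaf S I n)
  leaf-acc ℕ.zero        empty _   inv = ⊥-elim (empty _ (inLevel inv))
  leaf-acc (ℕ.suc k) {n} empty fresh inv = go fresh inv
    where
    empty′ : ∀ K → ¬ InLevel S (k + ℕ.suc n) K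
    empty′ K = subst (λ m → ¬ InLevel S m K) (sym (+-suc k n)) (empty K)

    go : ∀ {π I} → Acc (λ π ρ → Fresh n π ⊂ Fresh n ρ) π →
         Invariant π I n → Acc (flip (Step S π)) (leaf S I n)
    go {π} {I} (acc rs) inv = acc step-acc
      where
      step-acc : ∀ {T} → Step S π (leaf S I n) T → Acc (flip (Step S π)) T
      step-acc (repeat _) =
        node-acc (acc λ (α , _ , _ , eq , _) → ⊥-elim (childless α eq))
      step-acc (accelerate {J = J} _ able accel children) =
        children-acc children λ J→K →
          -- With the new counter, freshness is measured anew; the descent restarts.
          leaf-acc k empty′ (Fresh-wellFounded _ _)
            (invariant-step J→K (invariant-accelerate {J = J} able accel inv))
      step-acc (expand ¬rep ¬able children) =
        children-acc children λ I→K →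
          go (rs (Fresh-∷-⊂ ¬rep ¬able)) (invariant-step I→K inv)
      step-acc (below {α = α} eq _) = ⊥-elim (childless α eq)

  -- Progress: a stuck tree is fully marked.

  children-exist : ∀ I n → ∃ (Children S I n)
  children-exist I n = Vec.tabulate (proj₁ ∘ child) , λ α →
    subst (Child S I n α) (sym (lookup∘tabulate (proj₁ ∘ child) α)) (proj₂ (child α))
    where
    child : ∀ α → ∃ (Child S I n α)
    child α with em {P = ∃ λ K → Comp.step α I K}
    ... | yes (K , I→K) = just (leaf S K n) , defined I→K
    ... | no  I↛        = nothing , undefined I↛

  -- Excluded middle selects the applicable case of the loop; its acceleration and children always
  -- exist.
  unmarked-progress : ∀ π I n ts → ∃ (Step S π (node I n false ts))
  unmarked-progress π I n ts with em {P = Repeated S π I}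
  ... | yes rep = _ , repeat rep
  ... | no ¬rep with em {P = ∃ λ w → Accelerable S π I n w}
  ...   | no ¬able = 
    let us , children = children-exist I n
    in  _ , expand {us = us} ¬rep ¬able children
  ...   | yes (w , able) =
    let J , accel = acceleration-exists w I
        us , children = children-exist J (ℕ.suc n)
    in  _ , accelerate {us = us} ¬rep able accel children

  mutual
    stuck⇒marked : ∀ π T → (∀ T′ → ¬ Step S π T T′) → FullyMarked S T
    stuck⇒marked π (node I n false ts) stuck =
      let T′ , s = unmarked-progress π I n ts in ⊥-elim (stuck T′ s)
    stuck⇒marked π (node I n true ts) stuck =
      node (stuck⇒children-marked ts (λ α → (I , n , α) ∷ π)
              λ α eq T′ s → stuck _ (below eq s))

    -- Generalised to arbitrary vectors and branches so that the recursion can descend along the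
    -- list of children.
    stuck⇒children-marked : ∀ {k} (ts : Vec (Maybe (Tree S)) k) (π : Fin k → Branch S) →
      (∀ α {T} → lookup ts α ≡ just T → ∀ T′ → ¬ Step S (π α) T T′) →
      Vec.All (Maybe.All (FullyMarked S)) ts
    stuck⇒children-marked []             π stuck = Vec.[]
    stuck⇒children-marked (nothing ∷ ts) π stuck =
      Maybe.nothing Vec.∷ stuck⇒children-marked ts (π ∘ Fin.suc) (stuck ∘ Fin.suc)
    stuck⇒children-marked (just T ∷ ts)  π stuck =
      Maybe.just (stuck⇒marked (π Fin.zero) T (stuck Fin.zero refl)) Vec.∷
      stuck⇒children-marked ts (π ∘ Fin.suc) (stuck ∘ Fin.suc)

  terminates : ∀ I → Terminates (Step S []) (FullyMarked S) (leaf S I 0)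
  terminates I =
    -- The root has counter `0`, so the levels left to climb are given by the index of the empty
    -- level.
    leaf-acc (proj₁ finitelyManyLevels)
      (λ K → subst (λ m → ¬ InLevel S m K) (sym (+-identityʳ _)) (proj₂ finitelyManyLevels K))
      (Fresh-wellFounded 0 [])
      (record { inLevel = _ ; reached = λ () ; bounded = λ () }) ,
    λ T _ → stuck⇒marked [] T

theorem8 : ∀ {c ℓ₁ ℓ₂ t : Level} →
    ExcludedMiddle (suc (c ⊔ ℓ₂ ⊔ t)) →
    (S : LTS c ℓ₁ ℓ₂ t) → IsVeryWSTS S → (I₀ : Ideal S) →
    Terminates (Step S []) (FullyMarked S) (leaf S I₀ 0)
theorem8 em S very = KarpMiller.terminates em S very
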